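{- For all integers $s\geq 2$, \[\gamma(K_{s+2})\geq 1-\frac{1}{s},\] where $K_{s+2}$ is the complete 3-graph on $s+2$ vertices and $\gamma$ denotes codegree density.
   Context: A 3-graph is a pair $G=(V,E)$ with $V$ a finite vertex set and $E$ a set of 3-element subsets of $V$ (the 3-edges). A 3-graph contains another 3-graph $F$ as a subgraph if it has a (not necessarily induced) subgraph isomorphic to $F$. The complete 3-graph $K_t$ has vertex set $[t]=\{1,\dots,t\}$ and all 3-element subsets of $[t]$ as 3-edges. For a family $\mathcal{F}$ of non-empty 3-graphs (i.e. each having at least one 3-edge), the codegree threshold $\mathrm{coex}(n,\mathcal{F})$ is the largest integer $d$ such that there exists an $n$-vertex 3-graph in which every pair of distinct vertices is contained in at least $d$ 3-edges and which contains no member of $\mathcal{F}$ as a subgraph. The codegree density of $\mathcal{F}$ is $\gamma(\mathcal{F})=\lim_{n\to\infty}\frac{\mathrm{coex}(n,\mathcal{F})}{n-2}$; this limit is known to exist for every such $\mathcal{F}$ (Mubayi and Zhao). For a single 3-graph $F$, write $\gamma(F)=\gamma(\{F\})$. -}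

module Defs where

open import Data.Bool using (Bool; T)
open import Data.Fin using (Fin)
import Data.Fin.Properties as Fin
open import Data.Fin.Subset using (Subset; _∈_; ∣_∣)
open import Data.Fin.Subset.Properties using (_∈?_)
open import Data.Integer using (+_)
open import Data.Nat as ℕ using (ℕ; suc)
open import Data.Product using (Σ; ∃; ∃-syntax; _×_; _,_)
open import Data.Rational as ℚ using (ℚ; 0ℚ; 1ℚ; _<_; _/_)
import Data.Rational.Properties as ℚ
open import Data.Sum using (_⊎_; inj₁; inj₂)
open import Data.Vec using (tabulate)
open import Function.Definitions using (Injective)
open import Level using (0ℓ)
open import Relation.Binary.PropositionalEquality using (_≡_; _≢_; subst)
open import Relation.Nullary using (¬_; yes; no)
open import Relation.Nullary.Decidable using (⌊_⌋; _×-dec_; toWitness)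
open import Relation.Unary using (Pred; ｛_｝; _⊆_)

-- 3-graphs with vertex set Fin n.

record 3-Graph (n : ℕ) : Set where
  field
    edge    : Subset n → Bool
    uniform : ∀ e → T (edge e) → ∣ e ∣ ≡ 3

  Edge : Pred (Subset n) 0ℓ
  Edge e = T (edge e)

open 3-Graph public

K : (t : ℕ) → 3-Graph t
K t .edge e      = ⌊ ∣ e ∣ ℕ.≟ 3 ⌋
K t .uniform e p = toWitness p

image : ∀ {m n} → (Fin m → Fin n) → Subset m → Subset n
image f p = tabulate λ j → ⌊ Fin.any? (λ i → (i ∈? p) ×-dec (f i Fin.≟ j)) ⌋

Contains : ∀ {m n} → 3-Graph n → 3-Graph m → Set
Contains {m} {n} G F =
  Σ (Fin m → Fin n) λ f →
    Injective _≡_ _≡_ f × (∀ e → Edge F e → Edge G (image f e))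

AtLeast : ∀ {A : Set} → ℕ → Pred A 0ℓ → Set
AtLeast {A} d P =
  Σ (Fin d → A) λ f → Injective _≡_ _≡_ f × (∀ i → P (f i))

MinCodegree≥ : ∀ {n} → 3-Graph n → ℕ → Set
MinCodegree≥ G d =
  ∀ u v → u ≢ v → AtLeast d (λ e → Edge G e × u ∈ e × v ∈ e)

-- Members may be empty 3-graphs here. Non-emptiness of all members is what
-- guarantees that a codegree threshold exists.
Family : Set₁
Family = Pred (Σ ℕ 3-Graph) 0ℓ

_-free : ∀ {n} → Family → 3-Graph n → Set
(𝓕 -free) G = ∀ {m} (F : 3-Graph m) → 𝓕 (m , F) → ¬ Contains G F

Attainable : ℕ → Family → ℕ → Set
Attainable n 𝓕 d = Σ (3-Graph n) λ G → MinCodegree≥ G d × (𝓕 -free) G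

-- d = coex(n, 𝓕)
IsCoex : ℕ → Family → ℕ → Set
IsCoex n 𝓕 d = Attainable n 𝓕 d × (∀ d′ → Attainable n 𝓕 d′ → d′ ℕ.≤ d)

-- Dedekind reals: L q means q < x, and U q means x < q.

record ℝ : Set₁ where
  field
    L U         : Pred ℚ 0ℓ
    L-inhabited : ∃ L
    U-inhabited : ∃ U
    L-lower     : ∀ {p q} → p < q → L q → L p
    U-upper     : ∀ {p q} → p < q → U p → U q
    L-open      : ∀ {p} → L p → ∃[ q ] p < q × L q
    U-open      : ∀ {q} → U q → ∃[ p ] p < q × U p
    disjoint    : ∀ {q} → ¬ (L q × U q)
    located     : ∀ {p q} → p < q → L p ⊎ U q

open ℝ public

_≤ᵣ_ _≥ᵣ_ : ℝ → ℝ → Set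
x ≤ᵣ y = L x ⊆ L y
x ≥ᵣ y = y ≤ᵣ x

fromℚ : ℚ → ℝ
fromℚ r = record
  { L           = _< r
  ; U           = r <_
  ; L-inhabited = r ℚ.- 1ℚ , r-1<r
  ; U-inhabited = r ℚ.+ 1ℚ , r<r+1
  ; L-lower     = ℚ.<-trans
  ; U-upper     = λ p<q r<p → ℚ.<-trans r<p p<q
  ; L-open      = ℚ.<-dense
  ; U-open      = λ r<q → let m , r<m , m<q = ℚ.<-dense r<q in m , m<q , r<m
  ; disjoint    = λ (q<r , r<q) → ℚ.<-asym q<r r<q
  ; located     = locate
  }
  where
  r-1<r : r ℚ.- 1ℚ < r
  r-1<r = subst (r ℚ.- 1ℚ <_) (ℚ.+-identityʳ r)
            (ℚ.+-monoʳ-< r (ℚ.negative⁻¹ (ℚ.- 1ℚ)))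

  r<r+1 : r < r ℚ.+ 1ℚ
  r<r+1 = subst (_< r ℚ.+ 1ℚ) (ℚ.+-identityʳ r)
            (ℚ.+-monoʳ-< r (ℚ.positive⁻¹ 1ℚ))

  locate : ∀ {p q} → p < q → p < r ⊎ r < q
  locate {p} p<q with p ℚ.<? r
  ... | yes p<r = inj₁ p<r
  ... | no  p≮r = inj₂ (ℚ.≤-<-trans (ℚ.≮⇒≥ p≮r) p<q)

-- Convergence of a rational sequence: for every ε > 0, eventually
-- a n - ε < x < a n + ε.
_⟶_ : (ℕ → ℚ) → ℝ → Set
a ⟶ x = ∀ ε → 0ℚ < ε →
  ∃[ N ] (∀ n → N ℕ.≤ n → L x (a n ℚ.- ε) × U x (a n ℚ.+ ε))

-- x = γ(𝓕). For n < 2 there are no pairs of vertices, hence no largest d. The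
-- ratio coex(n, 𝓕) / (n - 2) is taken along n = 3 + m.
record IsCodegreeDensity (𝓕 : Family) (x : ℝ) : Set where
  field
    coex    : ℕ → ℕ
    isCoex  : ∀ n → 2 ℕ.≤ n → IsCoex n 𝓕 (coex n)
    isLimit : (λ m → + coex (3 ℕ.+ m) / suc m) ⟶ x

-- x = γ(F) = γ({F})
IsCodegreeDensityOf : ∀ {k} → 3-Graph k → ℝ → Set
IsCodegreeDensityOf {k} F = IsCodegreeDensity ｛ k , F ｝

{-# OPTIONS --safe #-}

-- Colour the pairs of an ordered vertex set with s colours, and let x < y < z
-- span an edge iff xy and xz have different colours. The s + 1 pairs at the least
-- vertex of a copy of K (s + 2) would need distinct colours, so there is no copy.
-- A random colouring gives codegrees of about (1 - 1/s) n; a pseudorandom one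
-- suffices. For a prime q the vertices are the triples (i , a , b) of residues
-- with a < q - 1, ordered by the block i first. Attach to (i , a , b) the quadratic
-- f(t) = b + a t + i t², and colour the pair of (i , a , b) and a later vertex with
-- quadratic f by ((a + 1) f(i) + b mod q) mod s. Two distinct quadratics meet at no
-- more than two points t; in any other block the pair (a , b) is determined by the
-- residues it gives to the two vertices. So only about n / s vertices form a
-- non-edge with a given pair. Since the density is assumed to exist, it may be
-- computed along n = q² (q - 1) with q prime.

module Submission where

open import Defs
open import Data.Integer using (+_)
open import Data.Nat using (ℕ; NonZero; _≤_; _+_)
open import Data.Rational using (1ℚ; _/_; _-_)

import Algebra.Properties.AbelianGroup as AbelianGroup
open import Data.Bool using (true; false)
open import Data.Bool.Properties using (T-≡)
open import Data.Fin as Fin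
  using (Fin; toℕ; fromℕ<; punchIn; inject≤; inject₁; combine; remQuot; join; splitAt)
import Data.Fin.Properties as Fin
open import Data.Fin.Subset using (Subset; _∈_; _∉_; ∣_∣; ⁅_⁆; _∪_)
open import Data.Fin.Subset.Properties
  using (_∈?_; x∈⁅x⁆; x∈⁅y⁆⇒x≡y; ∣⁅x⁆∣≡1; ∪-identityˡ; x∈p∪q⁺; x∈p∪q⁻)
open import Data.Integer as ℤ using (ℤ; -[1+_])
open import Data.Integer.Divisibility.Signed
  using (∣ᵤ⇒∣; ∣⇒∣ᵤ; ∣m∣n⇒∣m-n; ∣m∣n⇒∣m+n; ∣m⇒∣m*n)
  renaming (_∣_ to _∣ℤ_; divides to dividesℤ)
import Data.Integer.Properties as ℤ
import Data.Integer.Tactic.RingSolver as ℤSolver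
open import Data.List using ([]; _∷_)
open import Data.List.Relation.Unary.All using (_∷_)
open import Data.Nat as ℕ using (zero; suc; _*_; _∸_; _<_; s≤s; z≤n; _%_; _!)
open import Data.Nat.DivMod using (m%n<n; m%n%n≡m%n; m≡m%n+[m/n]*n; m/n*n≤m; /-monoˡ-≤)
open import Data.Nat.Divisibility
  using (_∣_; >⇒∤; ∣m+n∣m⇒∣n; ∣1⇒≡1; m∣m*n; ∣-trans; m≤n⇒m!∣n!)
open import Data.Nat.Primality using (Prime; euclidsLemma; ¬prime[1]; prime⇒nonZero)
open import Data.Nat.Primality.Factorisation using (factorise)
import Data.Nat.Properties as ℕ
import Data.Nat.Tactic.RingSolver as ℕSolver
open import Data.Product using (Σ; ∃; ∃₂; _×_; _,_; proj₁; proj₂)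
open import Data.Product.Properties using (,-injective)
open import Data.Rational as ℚ using (0ℚ; mkℚ)
import Data.Rational.Properties as ℚ
open import Data.Rational.Unnormalised as ℚᵘ using (mkℚᵘ; *<*)
import Data.Rational.Unnormalised.Properties as ℚᵘ
open import Data.Sum as Sum using (_⊎_; inj₁; inj₂; [_,_]′)
open import Data.Sum.Properties using (inj₁-injective; inj₂-injective)
open import Data.Vec using (_∷_; here; there)
open import Data.Vec.Properties using (lookup∘tabulate; lookup⇒[]=)
open import Function using (_∘_; id; case_of_)
open import Function.Bundles using (Equivalence)
open import Function.Definitions using (Injective)
open import Level using (0ℓ)
open import Relation.Binary.Definitions using (tri<; tri≈; tri>)
open import Relation.Binary.PropositionalEquality
open import Relation.Nullary using (¬_; yes; no; contradiction)
open import Relation.Nullary.Decidable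
  using (⌊_⌋; _×-dec_; _→-dec_; ¬?; toWitness; fromWitness; decidable-stable)
open import Relation.Unary using (Pred; Decidable; ∁; ｛_｝)

-- Counting with injections

AtLeast-map : ∀ {A B : Set} (P : Pred A 0ℓ) (Q : Pred B 0ℓ) {d} (h : A → B) →
  (∀ {x y} → P x → P y → h x ≡ h y → x ≡ y) → (∀ {x} → P x → Q (h x)) →
  AtLeast d P → AtLeast d Q
AtLeast-map P Q h h-inj P⇒Q (f , f-inj , Pf) =
  h ∘ f , (λ eq → f-inj (h-inj (Pf _) (Pf _) eq)) , λ i → P⇒Q (Pf i)

AtLeast-mono : ∀ {A : Set} (P : Pred A 0ℓ) {d e} → d ≤ e → AtLeast e P → AtLeast d P
AtLeast-mono P d≤e (f , f-inj , Pf) =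
  (λ i → f (inject≤ i d≤e)) , (λ eq → Fin.inject≤-injective d≤e d≤e _ _ (f-inj eq)) , λ i → Pf _

AtLeast-suc : ∀ {n d} (P : Pred (Fin (suc n)) 0ℓ) → AtLeast d (P ∘ Fin.suc) → AtLeast d P
AtLeast-suc P = AtLeast-map (P ∘ Fin.suc) P Fin.suc (λ _ _ → Fin.suc-injective) id

AtLeast-cons : ∀ {n d} (P : Pred (Fin (suc n)) 0ℓ) →
  P Fin.zero → AtLeast d (P ∘ Fin.suc) → AtLeast (suc d) P
AtLeast-cons {n} {d} P P0 (f , f-inj , Pf) = g , g-inj , Pg
  where
  g : Fin (suc d) → Fin (suc n)
  g Fin.zero    = Fin.zero
  g (Fin.suc i) = Fin.suc (f i)

  g-inj : Injective _≡_ _≡_ g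
  g-inj {Fin.zero}  {Fin.zero}  _  = refl
  g-inj {Fin.suc i} {Fin.suc j} eq = cong Fin.suc (f-inj (Fin.suc-injective eq))

  Pg : ∀ i → P (g i)
  Pg Fin.zero    = P0
  Pg (Fin.suc i) = Pf i

AtLeast-split : ∀ {n} {P : Pred (Fin n) 0ℓ} → Decidable P →
  ∃₂ λ a b → n ≡ a + b × AtLeast a P × AtLeast b (∁ P)
AtLeast-split {zero}  P? = 0 , 0 , refl , (id , id , λ ()) , (id , id , λ ())
AtLeast-split {suc n} {P} P? with P? Fin.zero | AtLeast-split (P? ∘ Fin.suc)
... | yes P0 | a , b , eq , as , bs =
  suc a , b , cong suc eq , AtLeast-cons P P0 as , AtLeast-suc (∁ P) bs
... | no ¬P0 | a , b , eq , as , bs =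
  a , suc b , trans (cong suc eq) (sym (ℕ.+-suc a b)) , AtLeast-suc P as , AtLeast-cons (∁ P) ¬P0 bs

-- The elements outside `P` inject into `Fin k`, so there are at most `k` of them. Codegrees are
-- bounded below in this way, by coding the bad vertices.
AtLeast-complement : ∀ {n k} {P : Pred (Fin n) 0ℓ} → Decidable P → (code : Fin n → Fin k) →
  (∀ {x y} → ¬ P x → ¬ P y → code x ≡ code y → x ≡ y) → AtLeast (n ∸ k) P
AtLeast-complement {k = k} {P} P? code code-inj with AtLeast-split P?
... | a , b , refl , as , (g , g-inj , ¬Pg) = AtLeast-mono P le as
  where
  b≤k : b ≤ k
  b≤k = Fin.injective⇒≤ {f = code ∘ g} λ eq → g-inj (code-inj (¬Pg _) (¬Pg _) eq)

  le : a + b ∸ k ≤ a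
  le = ℕ.≤-trans (ℕ.∸-monoʳ-≤ (a + b) b≤k) (ℕ.≤-reflexive (ℕ.m+n∸n≡m a b))

-- Three-element subsets

∣⁅x⁆∪p∣≡1+∣p∣ : ∀ {n} {x : Fin n} {p : Subset n} → x ∉ p → ∣ ⁅ x ⁆ ∪ p ∣ ≡ suc ∣ p ∣
∣⁅x⁆∪p∣≡1+∣p∣ {x = Fin.zero}  {true  ∷ p} x∉p = contradiction here x∉p
∣⁅x⁆∪p∣≡1+∣p∣ {x = Fin.zero}  {false ∷ p} x∉p = cong (suc ∘ ∣_∣) (∪-identityˡ p)
∣⁅x⁆∪p∣≡1+∣p∣ {x = Fin.suc x} {true  ∷ p} x∉p = cong suc (∣⁅x⁆∪p∣≡1+∣p∣ (x∉p ∘ there))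
∣⁅x⁆∪p∣≡1+∣p∣ {x = Fin.suc x} {false ∷ p} x∉p = ∣⁅x⁆∪p∣≡1+∣p∣ (x∉p ∘ there)

triple : ∀ {n} → Fin n → Fin n → Fin n → Subset n
triple x y z = ⁅ x ⁆ ∪ (⁅ y ⁆ ∪ ⁅ z ⁆)

module _ {n} (x y z : Fin n) where

  ∈triple⁻ : ∀ {t} → t ∈ triple x y z → t ≡ x ⊎ t ≡ y ⊎ t ≡ z
  ∈triple⁻ t∈ with x∈p∪q⁻ ⁅ x ⁆ _ t∈
  ... | inj₁ t∈x = inj₁ (x∈⁅y⁆⇒x≡y x t∈x)
  ... | inj₂ t∈yz with x∈p∪q⁻ ⁅ y ⁆ _ t∈yz
  ...   | inj₁ t∈y = inj₂ (inj₁ (x∈⁅y⁆⇒x≡y y t∈y))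
  ...   | inj₂ t∈z = inj₂ (inj₂ (x∈⁅y⁆⇒x≡y z t∈z))

  first∈triple : x ∈ triple x y z
  first∈triple = x∈p∪q⁺ (inj₁ (x∈⁅x⁆ x))

  second∈triple : y ∈ triple x y z
  second∈triple = x∈p∪q⁺ {p = ⁅ x ⁆} (inj₂ (x∈p∪q⁺ (inj₁ (x∈⁅x⁆ y))))

  third∈triple : z ∈ triple x y z
  third∈triple = x∈p∪q⁺ {p = ⁅ x ⁆} (inj₂ (x∈p∪q⁺ {p = ⁅ y ⁆} (inj₂ (x∈⁅x⁆ z))))

  ∣triple∣≡3 : x ≢ y → x ≢ z → y ≢ z → ∣ triple x y z ∣ ≡ 3
  ∣triple∣≡3 x≢y x≢z y≢z = begin
    ∣ triple x y z ∣            ≡⟨ ∣⁅x⁆∪p∣≡1+∣p∣ x∉yz ⟩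
    suc ∣ ⁅ y ⁆ ∪ ⁅ z ⁆ ∣       ≡⟨ cong suc (∣⁅x⁆∪p∣≡1+∣p∣ (y≢z ∘ x∈⁅y⁆⇒x≡y z)) ⟩
    suc (suc ∣ ⁅ z ⁆ ∣)         ≡⟨ cong (suc ∘ suc) (∣⁅x⁆∣≡1 z) ⟩
    3                           ∎
    where
    open ≡-Reasoning
    x∉yz : x ∉ ⁅ y ⁆ ∪ ⁅ z ⁆
    x∉yz x∈ = [ x≢y ∘ x∈⁅y⁆⇒x≡y y , x≢z ∘ x∈⁅y⁆⇒x≡y z ]′ (x∈p∪q⁻ ⁅ y ⁆ _ x∈)

∈-image : ∀ {m n} (f : Fin m → Fin n) {p : Subset m} {i} → i ∈ p → f i ∈ image f p
∈-image f {p} {i} i∈p = lookup⇒[]= (f i) _ (trans (lookup∘tabulate _ (f i))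
  (Equivalence.to T-≡ (fromWitness (i , i∈p , refl))))

-- The 3-graph of a colouring of pairs

argmin : ∀ {m n} (f : Fin (suc m) → Fin n) → ∃ λ k → ∀ i → toℕ (f k) ≤ toℕ (f i)
argmin {zero}  f = Fin.zero , λ { Fin.zero → ℕ.≤-refl }
argmin {suc m} f with argmin (f ∘ Fin.suc)
... | k , min with ℕ.≤-total (toℕ (f Fin.zero)) (toℕ (f (Fin.suc k)))
...   | inj₁ f0≤ = Fin.zero , λ { Fin.zero → ℕ.≤-refl ; (Fin.suc i) → ℕ.≤-trans f0≤ (min i) }
...   | inj₂ ≤f0 = Fin.suc k , λ { Fin.zero → ≤f0 ; (Fin.suc i) → min i }

module _ {n} (c : Fin n → Fin n → ℕ) where

  -- In a set of three vertices only the least can play the role of `x`, since two distinct members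
  -- must lie above it. So colours are compared at the least vertex alone, without listing the set
  -- in order.
  Rainbow : Pred (Subset n) 0ℓ
  Rainbow e = ∀ x y z → x ∈ e → y ∈ e → z ∈ e →
    x Fin.< y → x Fin.< z → y ≢ z → c x y ≢ c x z

  rainbow? : Decidable Rainbow
  rainbow? e = Fin.all? λ x → Fin.all? λ y → Fin.all? λ z →
    (x ∈? e) →-dec (y ∈? e) →-dec (z ∈? e) →-dec
    (x Fin.<? y) →-dec (x Fin.<? z) →-dec ¬? (y Fin.≟ z) →-dec ¬? (c x y ℕ.≟ c x z)

  rainbowGraph : 3-Graph n
  rainbowGraph .edge e      = ⌊ (∣ e ∣ ℕ.≟ 3) ×-dec rainbow? e ⌋
  rainbowGraph .uniform e p = proj₁ (toWitness {a? = (∣ e ∣ ℕ.≟ 3) ×-dec rainbow? e} p)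

  rainbowGraph-free : ∀ {s} → (∀ x y → c x y < s) → ¬ Contains rainbowGraph (K (suc (suc s)))
  rainbowGraph-free {s} c<s (f , f-inj , f-edge) =
    rainbow (f m) (f y) (f z) (∈-image f (first∈triple m y z)) (∈-image f (second∈triple m y z))
      (∈-image f (third∈triple m y z)) (m< i) (m< j) (y≢z ∘ f-inj)
      (Fin.fromℕ<-injective _ _ (c<s _ _) (c<s _ _) same)
    where
    m   = proj₁ (argmin f)

    m< : ∀ k → f m Fin.< f (punchIn m k)
    m< k = Fin.≤∧≢⇒< (proj₂ (argmin f) (punchIn m k))
      λ eq → Fin.punchInᵢ≢i m k (sym (f-inj eq))

    -- `punchIn m` runs through the `s + 1` other vertices of the copy, and their pairs with `f m`
    -- have only `s` colours.
    hole = Fin.pigeonhole (ℕ.n<1+n s) (λ k → Fin.fromℕ< (c<s (f m) (f (punchIn m k))))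
    i    = proj₁ hole
    j    = proj₁ (proj₂ hole)
    same = proj₂ (proj₂ (proj₂ hole))
    y    = punchIn m i
    z    = punchIn m j

    y≢z : y ≢ z
    y≢z eq = Fin.<⇒≢ (proj₁ (proj₂ (proj₂ hole))) (Fin.punchIn-injective m i j eq)

    rainbow : Rainbow (image f (triple m y z))
    rainbow = proj₂ (toWitness {a? = (_ ℕ.≟ 3) ×-dec rainbow? (image f (triple m y z))}
      (f-edge (triple m y z) (fromWitness
        (∣triple∣≡3 m y z (Fin.punchInᵢ≢i m i ∘ sym) (Fin.punchInᵢ≢i m j ∘ sym) y≢z))))

  -- Meant for `u < v`: the least of the three vertices is then the smaller of `w` and `u`, so the
  -- position of `w` relative to `u` decides which colours to compare. The choice `w = v` is
  -- excluded by the last condition, which would make `c u v` differ from itself.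
  Good : Fin n → Fin n → Pred (Fin n) 0ℓ
  Good u v w = w ≢ u × (w Fin.< u → c w u ≢ c w v) × (u Fin.< w → c u w ≢ c u v)

  good? : ∀ u v → Decidable (Good u v)
  good? u v w = ¬? (w Fin.≟ u) ×-dec
    ((w Fin.<? u) →-dec ¬? (c w u ℕ.≟ c w v)) ×-dec
    ((u Fin.<? w) →-dec ¬? (c u w ℕ.≟ c u v))

  EdgeThrough : Fin n → Fin n → Pred (Subset n) 0ℓ
  EdgeThrough u v e = Edge rainbowGraph e × u ∈ e × v ∈ e

  module _ {u v : Fin n} (u<v : u Fin.< v) where

    good⇒≢ : ∀ {w} → Good u v w → w ≢ v
    good⇒≢ (_ , _ , above) refl = above u<v refl

    good⇒edge : ∀ {w} → Good u v w → Edge rainbowGraph (triple w u v)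
    good⇒edge {w} g@(w≢u , below , above) =
      fromWitness (∣triple∣≡3 w u v w≢u (good⇒≢ g) (Fin.<⇒≢ u<v) , rainbow)
      where
      rainbow : Rainbow (triple w u v)
      rainbow x y z x∈ y∈ z∈ x<y x<z y≢z
        with ∈triple⁻ w u v x∈ | ∈triple⁻ w u v y∈ | ∈triple⁻ w u v z∈
      ... | inj₁ refl | inj₁ refl | _ = contradiction refl (Fin.<⇒≢ x<y)
      ... | inj₁ refl | _ | inj₁ refl = contradiction refl (Fin.<⇒≢ x<z)
      ... | inj₁ refl | inj₂ (inj₁ refl) | inj₂ (inj₁ refl) = contradiction refl y≢z
      ... | inj₁ refl | inj₂ (inj₁ refl) | inj₂ (inj₂ refl) = below x<y
      ... | inj₁ refl | inj₂ (inj₂ refl) | inj₂ (inj₁ refl) = below x<z ∘ sym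
      ... | inj₁ refl | inj₂ (inj₂ refl) | inj₂ (inj₂ refl) = contradiction refl y≢z
      ... | inj₂ (inj₁ refl) | inj₁ refl | inj₁ refl = contradiction refl y≢z
      ... | inj₂ (inj₁ refl) | inj₁ refl | inj₂ (inj₂ refl) = above x<y
      ... | inj₂ (inj₁ refl) | inj₂ (inj₁ refl) | _ = contradiction refl (Fin.<⇒≢ x<y)
      ... | inj₂ (inj₁ refl) | _ | inj₂ (inj₁ refl) = contradiction refl (Fin.<⇒≢ x<z)
      ... | inj₂ (inj₁ refl) | inj₂ (inj₂ refl) | inj₁ refl = above x<z ∘ sym
      ... | inj₂ (inj₁ refl) | inj₂ (inj₂ refl) | inj₂ (inj₂ refl) = contradiction refl y≢z
      -- `x` is never `v`: two distinct members above `v` would include `u`.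
      ... | inj₂ (inj₂ refl) | inj₂ (inj₁ refl) | _ = contradiction x<y (Fin.<-asym u<v)
      ... | inj₂ (inj₂ refl) | inj₂ (inj₂ refl) | _ = contradiction refl (Fin.<⇒≢ x<y)
      ... | inj₂ (inj₂ refl) | _ | inj₂ (inj₁ refl) = contradiction x<z (Fin.<-asym u<v)
      ... | inj₂ (inj₂ refl) | _ | inj₂ (inj₂ refl) = contradiction refl (Fin.<⇒≢ x<z)
      ... | inj₂ (inj₂ refl) | inj₁ refl | inj₁ refl = contradiction refl y≢z

    -- Distinct good `w` give distinct edges, because `w` is the only member of `triple w u v` other
    -- than `u` and `v`.
    codegree-< : ∀ {d} → AtLeast d (Good u v) → AtLeast d (EdgeThrough u v)
    codegree-< = AtLeast-map (Good u v) (EdgeThrough u v) (λ w → triple w u v) inj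
      λ {w} g → good⇒edge g , second∈triple w u v , third∈triple w u v
      where
      inj : ∀ {w w′} → Good u v w → Good u v w′ → triple w u v ≡ triple w′ u v → w ≡ w′
      inj {w} {w′} g@(w≢u , _) _ eq
        with ∈triple⁻ w′ u v (subst (w ∈_) eq (first∈triple w u v))
      ... | inj₁ w≡w′        = w≡w′
      ... | inj₂ (inj₁ w≡u) = contradiction w≡u w≢u
      ... | inj₂ (inj₂ w≡v) = contradiction w≡v (good⇒≢ g)

  minCodegree : ∀ {d} → (∀ {u v} → u Fin.< v → AtLeast d (Good u v)) →
    MinCodegree≥ rainbowGraph d
  minCodegree many u v u≢v with Fin.<-cmp u v
  ... | tri< u<v _ _ = codegree-< u<v (many u<v)
  ... | tri≈ _ u≡v _ = contradiction u≡v u≢v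
  ... | tri> _ _ v<u = AtLeast-map (EdgeThrough v u) (EdgeThrough u v) id (λ _ _ → id) (λ (e , v∈ , u∈) → e , u∈ , v∈)
                         (codegree-< v<u (many v<u))

rainbow-attainable : ∀ {n s d} (c : Fin n → Fin n → ℕ) → (∀ x y → c x y < s) →
  (∀ {u v} → u Fin.< v → AtLeast d (Good c u v)) → Attainable n ｛ s + 2 , K (s + 2) ｝ d
rainbow-attainable {s = s} c c<s many = rainbowGraph c , minCodegree c many , λ where
  _ refl → subst (λ t → ¬ Contains (rainbowGraph c) (K t)) (ℕ.+-comm 2 s) (rainbowGraph-free c c<s)

-- Arbitrarily large primes

primeAbove : ∀ N → ∃ λ q → Prime q × N < q
primeAbove N with factorise (suc (N !))
... | record { factors = []    ; isFactorisation = eq } =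
  contradiction (ℕ.suc-injective eq) (ℕ.n>0⇒n≢0 (ℕ.1≤n! N))
-- Euclid's argument: a prime factor of `N ! + 1` that is at most `N` divides `N !` too, hence
-- divides 1.
... | record { factors = q ∷ qs ; isFactorisation = eq ; factorsPrime = q-prime ∷ _ } =
  q , q-prime , ℕ.≰⇒> λ q≤N → ¬prime[1] (subst Prime (∣1⇒≡1
    (∣m+n∣m⇒∣n (subst (q ∣_) (trans (sym eq) (ℕ.+-comm 1 (N !))) (m∣m*n _)) (q∣N! q q≤N q-prime)))
    q-prime)
  where
  q∣N! : ∀ q → q ≤ N → Prime q → q ∣ N !
  q∣N! zero    _   q-prime = contradiction refl (ℕ.≢-nonZero⁻¹ 0 ⦃ prime⇒nonZero q-prime ⦄)
  q∣N! (suc r) q≤N _       = ∣-trans (m∣m*n (r !)) (m≤n⇒m!∣n! q≤N)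

-- Codes in finite sets

AtMostTwo : ∀ {n} → Pred (Fin n) 0ℓ → Set
AtMostTwo Q = ∀ {i j k} → Q i → Q j → Q k → i ≢ j → i ≢ k → ¬ (j ≢ k)

-- If `Q r` holds, one tag goes to `r` and the other to everything else. Two distinct solutions with
-- the second tag would be three together with `r`.
atMostTwo⇒code : ∀ {n} {Q : Pred (Fin n) 0ℓ} → Decidable Q → AtMostTwo Q →
  Σ (Fin n → Fin 2) λ t → ∀ {i j} → Q i → Q j → t i ≡ t j → i ≡ j
atMostTwo⇒code {n} {Q} Q? two with Fin.any? Q?
... | no none      = (λ _ → Fin.zero) , λ Qi _ _ → contradiction (_ , Qi) none
... | yes (r , Qr) = t , t-inj
  where
  t : Fin n → Fin 2
  t i with i Fin.≟ r
  ... | yes _ = Fin.zero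
  ... | no  _ = Fin.suc Fin.zero

  t-inj : ∀ {i j} → Q i → Q j → t i ≡ t j → i ≡ j
  t-inj {i} {j} Qi Qj eq with i Fin.≟ r | j Fin.≟ r
  ... | yes refl | yes refl = refl
  ... | no i≢r   | no j≢r with i Fin.≟ j
  ...   | yes i≡j = i≡j
  ...   | no  i≢j = contradiction (j≢r ∘ sym) (two Qi Qr Qj i≢r i≢j)

combine₃ : ∀ {a b c} → Fin a × Fin b × Fin c → Fin (a * (b * c))
combine₃ (x , y , z) = combine x (combine y z)

combine₃-injective : ∀ {a b c} {x y : Fin a × Fin b × Fin c} → combine₃ x ≡ combine₃ y → x ≡ y
combine₃-injective {x = x , y , z} {x′ , y′ , z′} eq
  with refl , eq′ ← Fin.combine-injective x (combine y z) x′ (combine y′ z′) eq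
  with refl , refl ← Fin.combine-injective y z y′ z′ eq′ = refl

pack : ∀ {a b c d e f} → (Fin a × Fin b × Fin c) ⊎ (Fin d × Fin e × Fin f) →
  Fin (a * (b * c) + d * (e * f))
pack {a} {b} {c} {d} {e} {f} = join (a * (b * c)) (d * (e * f)) ∘ Sum.map combine₃ combine₃

pack-injective : ∀ {a b c d e f} {x y : (Fin a × Fin b × Fin c) ⊎ (Fin d × Fin e × Fin f)} →
  pack x ≡ pack y → x ≡ y
pack-injective {a} {b} {c} {d} {e} {f} {x} {y} eq = go x y
  (trans (sym (Fin.splitAt-join k l _)) (trans (cong (splitAt k) eq) (Fin.splitAt-join k l _)))
  where
  k = a * (b * c)
  l = d * (e * f)

  go : ∀ x y → Sum.map combine₃ combine₃ x ≡ Sum.map combine₃ combine₃ y → x ≡ y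
  go (inj₁ x) (inj₁ y) eq = cong inj₁ (combine₃-injective (inj₁-injective eq))
  go (inj₂ x) (inj₂ y) eq = cong inj₂ (combine₃-injective (inj₂-injective eq))

%-/-injective : ∀ {x y} s .⦃ _ : NonZero s ⦄ → x % s ≡ y % s → x ℕ./ s ≡ y ℕ./ s → x ≡ y
%-/-injective {x} {y} s %≡ /≡ = begin
  x                     ≡⟨ m≡m%n+[m/n]*n x s ⟩
  x % s + (x ℕ./ s) * s   ≡⟨ cong₂ (λ r t → r + t * s) %≡ /≡ ⟩
  y % s + (y ℕ./ s) * s   ≡⟨ m≡m%n+[m/n]*n y s ⟨
  y                     ∎
  where open ≡-Reasoning

-- Congruences modulo a prime

module Modular (q : ℕ) .⦃ _ : NonZero q ⦄ (q-prime : Prime q) where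

  infix 4 _≈_
  -- Being a record, a congruence determines its two sides for inference, which divisibility of the
  -- bare difference would not.
  record _≈_ (x y : ℤ) : Set where
    constructor ∣⇒≈
    field ≈⇒∣ : + q ∣ℤ x ℤ.- y

  open _≈_

  %≡⇒≈ : ∀ x y → x % q ≡ y % q → + x ≈ + y
  %≡⇒≈ x y eq = ∣⇒≈ (dividesℤ (+ (x ℕ./ q) ℤ.- + (y ℕ./ q)) (begin
    + x ℤ.- + y
      ≡⟨ cong₂ ℤ._-_ (expand x) (expand y) ⟩
    (+ (x % q) ℤ.+ + (x ℕ./ q) ℤ.* + q) ℤ.- (+ (y % q) ℤ.+ + (y ℕ./ q) ℤ.* + q)
      ≡⟨ cong (λ r → (r ℤ.+ + (x ℕ./ q) ℤ.* + q) ℤ.- (+ (y % q) ℤ.+ + (y ℕ./ q) ℤ.* + q)) (cong +_ eq) ⟩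
    (+ (y % q) ℤ.+ + (x ℕ./ q) ℤ.* + q) ℤ.- (+ (y % q) ℤ.+ + (y ℕ./ q) ℤ.* + q)
      ≡⟨ identity (+ (y % q)) (+ (x ℕ./ q)) (+ (y ℕ./ q)) (+ q) ⟩
    (+ (x ℕ./ q) ℤ.- + (y ℕ./ q)) ℤ.* + q ∎))
    where
    open ≡-Reasoning
    expand : ∀ z → + z ≡ + (z % q) ℤ.+ + (z ℕ./ q) ℤ.* + q
    expand z = trans (cong +_ (m≡m%n+[m/n]*n z q))
      (trans (ℤ.pos-+ (z % q) _) (cong (ℤ._+_ (+ (z % q))) (ℤ.pos-* (z ℕ./ q) q)))

    identity : ∀ r a b k → (r ℤ.+ a ℤ.* k) ℤ.- (r ℤ.+ b ℤ.* k) ≡ (a ℤ.- b) ℤ.* k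
    identity = ℤSolver.solve-∀

  -- The difference has absolute value at most the larger of `x` and `y`, hence below `q`, and the
  -- only multiple of `q` that small is 0.
  ≈⇒≡ : ∀ {x y} → x < q → y < q → + x ≈ + y → x ≡ y
  ≈⇒≡ {x} {y} x<q y<q x≈y = ℤ.+-injective (ℤ.i-j≡0⇒i≡j (+ x) (+ y) (ℤ.∣i∣≡0⇒i≡0 (vanishes (∣⇒∣ᵤ (≈⇒∣ x≈y)) small)))
    where
    vanishes : ∀ {m} → q ∣ m → m < q → m ≡ 0
    vanishes {zero}  _   _   = refl
    vanishes {suc m} q∣m m<q = contradiction q∣m (>⇒∤ m<q)

    small : ℤ.∣ + x ℤ.- + y ∣ < q
    small = ℕ.≤-<-trans (subst (λ z → ℤ.∣ z ∣ ≤ x ℕ.⊔ y) (sym (ℤ.m-n≡m⊖n x y)) (ℤ.∣m⊝n∣≤m⊔n x y))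
      (ℕ.⊔-pres-<m x<q y<q)

  ≈⇒%≡ : ∀ x y → + x ≈ + y → x % q ≡ y % q
  ≈⇒%≡ x y x≈y = ≈⇒≡ (m%n<n x q) (m%n<n y q)
    (∣⇒≈ (subst (+ q ∣ℤ_) (identity (+ x) (+ y) (+ (x % q)) (+ (y % q)))
      (∣m∣n⇒∣m-n (≈⇒∣ x≈y) (∣m∣n⇒∣m-n (≈⇒∣ (reduce x)) (≈⇒∣ (reduce y))))))
    where
    reduce : ∀ z → + z ≈ + (z % q)
    reduce z = %≡⇒≈ z (z % q) (sym (m%n%n≡m%n z q))

    identity : ∀ x y r t → (x ℤ.- y) ℤ.- ((x ℤ.- r) ℤ.- (y ℤ.- t)) ≡ r ℤ.- t
    identity = ℤSolver.solve-∀

  prime-∣ : ∀ x y → + q ∣ℤ x ℤ.* y → + q ∣ℤ x ⊎ + q ∣ℤ y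
  prime-∣ x y d = Sum.map ∣ᵤ⇒∣ ∣ᵤ⇒∣
    (euclidsLemma ℤ.∣ x ∣ ℤ.∣ y ∣ q-prime (subst (q ∣_) (ℤ.abs-* x y) (∣⇒∣ᵤ d)))

  -- This is where primality of `q` acts: Euclid's lemma allows division by a difference that is
  -- nonzero modulo `q`.
  cancel : ∀ {x y z} → ¬ x ≈ y → + q ∣ℤ (x ℤ.- y) ℤ.* z → + q ∣ℤ z
  cancel {x} {y} {z} x≉y d = [ (λ q∣x-y → contradiction (∣⇒≈ q∣x-y) x≉y) , id ]′ (prime-∣ (x ℤ.- y) z d)

  -- Horner form with leading coefficient `a`, the same shape as `curve` below.
  quadratic : ℤ → ℤ → ℤ → ℤ → ℤ
  quadratic a b c t = c ℤ.+ (b ℤ.+ a ℤ.* t) ℤ.* t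

  -- The difference of the quadratics has three distinct roots. Its divided differences at `t₁`,
  -- `t₂` and at `t₁`, `t₃` vanish; subtracting them isolates the leading coefficient, and back
  -- substitution gives the other two.
  quadratic-roots : ∀ a b c a′ b′ c′ t₁ t₂ t₃ →
    ¬ t₁ ≈ t₂ → ¬ t₁ ≈ t₃ → ¬ t₂ ≈ t₃ →
    quadratic a b c t₁ ≈ quadratic a′ b′ c′ t₁ →
    quadratic a b c t₂ ≈ quadratic a′ b′ c′ t₂ →
    quadratic a b c t₃ ≈ quadratic a′ b′ c′ t₃ →
    a ≈ a′ × b ≈ b′ × c ≈ c′
  quadratic-roots a b c a′ b′ c′ t₁ t₂ t₃ t₁≉t₂ t₁≉t₃ t₂≉t₃ (∣⇒≈ e₁) (∣⇒≈ e₂) (∣⇒≈ e₃) =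
    ∣⇒≈ a≈ , ∣⇒≈ b≈ , ∣⇒≈ c≈
    where
    divided : ∀ {t u} → ¬ t ≈ u →
      + q ∣ℤ quadratic a b c t ℤ.- quadratic a′ b′ c′ t →
      + q ∣ℤ quadratic a b c u ℤ.- quadratic a′ b′ c′ u →
      + q ∣ℤ (b ℤ.- b′) ℤ.+ (a ℤ.- a′) ℤ.* (t ℤ.+ u)
    divided {t} {u} t≉u et eu =
      cancel t≉u (subst (+ q ∣ℤ_) (identity a b c a′ b′ c′ t u) (∣m∣n⇒∣m-n et eu))
      where
      identity : ∀ a b c a′ b′ c′ t u →
        ((c ℤ.+ (b ℤ.+ a ℤ.* t) ℤ.* t) ℤ.- (c′ ℤ.+ (b′ ℤ.+ a′ ℤ.* t) ℤ.* t)) ℤ.-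
        ((c ℤ.+ (b ℤ.+ a ℤ.* u) ℤ.* u) ℤ.- (c′ ℤ.+ (b′ ℤ.+ a′ ℤ.* u) ℤ.* u)) ≡
        (t ℤ.- u) ℤ.* ((b ℤ.- b′) ℤ.+ (a ℤ.- a′) ℤ.* (t ℤ.+ u))
      identity = ℤSolver.solve-∀

    slope₁₂ = divided t₁≉t₂ e₁ e₂

    a≈ : + q ∣ℤ a ℤ.- a′
    a≈ = cancel t₂≉t₃ (subst (+ q ∣ℤ_) (identity (b ℤ.- b′) (a ℤ.- a′) t₁ t₂ t₃) (∣m∣n⇒∣m-n slope₁₂ (divided t₁≉t₃ e₁ e₃)))
      where
      identity : ∀ b a t u v → (b ℤ.+ a ℤ.* (t ℤ.+ u)) ℤ.- (b ℤ.+ a ℤ.* (t ℤ.+ v)) ≡ (u ℤ.- v) ℤ.* a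
      identity = ℤSolver.solve-∀

    b≈ : + q ∣ℤ b ℤ.- b′
    b≈ = subst (+ q ∣ℤ_) (identity (b ℤ.- b′) ((a ℤ.- a′) ℤ.* (t₁ ℤ.+ t₂)))
      (∣m∣n⇒∣m-n slope₁₂ (∣m⇒∣m*n (t₁ ℤ.+ t₂) a≈))
      where
      identity : ∀ x y → (x ℤ.+ y) ℤ.- y ≡ x
      identity = ℤSolver.solve-∀

    c≈ : + q ∣ℤ c ℤ.- c′
    c≈ = subst (+ q ∣ℤ_) (identity a b c a′ b′ c′ t₁)
      (∣m∣n⇒∣m-n e₁ (∣m⇒∣m*n t₁ (∣m∣n⇒∣m+n b≈ (∣m⇒∣m*n t₁ a≈))))
      where
      identity : ∀ a b c a′ b′ c′ t →
        ((c ℤ.+ (b ℤ.+ a ℤ.* t) ℤ.* t) ℤ.- (c′ ℤ.+ (b′ ℤ.+ a′ ℤ.* t) ℤ.* t)) ℤ.-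
        ((b ℤ.- b′) ℤ.+ (a ℤ.- a′) ℤ.* t) ℤ.* t ≡ c ℤ.- c′
      identity = ℤSolver.solve-∀

  -- The two sides differ by `α` times `c - c′`. The common shift `k` will be the nonconstant part
  -- of the quadratics of two vertices with the same block and slope.
  affine-injective : ∀ α β c c′ k → ¬ α ≈ + 0 →
    α ℤ.* (c ℤ.+ k) ℤ.+ β ≈ α ℤ.* (c′ ℤ.+ k) ℤ.+ β → c ≈ c′
  affine-injective α β c c′ k α≉0 (∣⇒≈ e) = ∣⇒≈ (cancel α≉0 (subst (+ q ∣ℤ_) (identity α β c c′ k) e))
    where
    identity : ∀ α β c c′ k → (α ℤ.* (c ℤ.+ k) ℤ.+ β) ℤ.- (α ℤ.* (c′ ℤ.+ k) ℤ.+ β) ≡ (α ℤ.- + 0) ℤ.* (c ℤ.- c′)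
    identity = ℤSolver.solve-∀

  -- The degree-one analogue of `quadratic-roots`: subtracting the congruences leaves the product of
  -- `x - y` and `α - α′`.
  two-points : ∀ α β α′ β′ x y → ¬ x ≈ y →
    α ℤ.* x ℤ.+ β ≈ α′ ℤ.* x ℤ.+ β′ → α ℤ.* y ℤ.+ β ≈ α′ ℤ.* y ℤ.+ β′ → α ≈ α′ × β ≈ β′
  two-points α β α′ β′ x y x≉y (∣⇒≈ ex) (∣⇒≈ ey) =
    ∣⇒≈ α≈ , ∣⇒≈ (subst (+ q ∣ℤ_) (identity₂ α β α′ β′ x) (∣m∣n⇒∣m-n ex (∣m⇒∣m*n x α≈)))
    where
    identity₁ : ∀ α β α′ β′ x y →
      ((α ℤ.* x ℤ.+ β) ℤ.- (α′ ℤ.* x ℤ.+ β′)) ℤ.- ((α ℤ.* y ℤ.+ β) ℤ.- (α′ ℤ.* y ℤ.+ β′)) ≡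
      (x ℤ.- y) ℤ.* (α ℤ.- α′)
    identity₁ = ℤSolver.solve-∀
    α≈ : + q ∣ℤ α ℤ.- α′
    α≈ = cancel x≉y (subst (+ q ∣ℤ_) (identity₁ α β α′ β′ x y) (∣m∣n⇒∣m-n ex ey))
    identity₂ : ∀ α β α′ β′ x →
      ((α ℤ.* x ℤ.+ β) ℤ.- (α′ ℤ.* x ℤ.+ β′)) ℤ.- (α ℤ.- α′) ℤ.* x ≡ β ℤ.- β′
    identity₂ = ℤSolver.solve-∀

-- The colouring by quadratics over a prime field

module Construction (s : ℕ) .⦃ _ : NonZero s ⦄ (p : ℕ) (q-prime : Prime (suc p)) where

  q n : ℕ
  q = suc p
  n = q * (p * q)

  open Modular q q-prime

  block : Fin n → Fin q
  block w = proj₁ (remQuot (p * q) w)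

  inner : Fin n → Fin (p * q)
  inner w = proj₂ (remQuot {q} (p * q) w)

  slope : Fin n → Fin p
  slope w = proj₁ (remQuot q (inner w))

  offset : Fin n → Fin q
  offset w = proj₂ (remQuot {p} q (inner w))

  combine-block-inner : ∀ w → combine (block w) (inner w) ≡ w
  combine-block-inner = Fin.combine-remQuot {q} (p * q)

  vertex-≡ : ∀ {w w′} → block w ≡ block w′ → slope w ≡ slope w′ → offset w ≡ offset w′ → w ≡ w′
  vertex-≡ {w} {w′} b≡ s≡ o≡ = begin
    w                            ≡⟨ combine-block-inner w ⟨
    combine (block w) (inner w)  ≡⟨ cong₂ combine b≡ (begin
      inner w                         ≡⟨ Fin.combine-remQuot {p} q (inner w) ⟨
      combine (slope w) (offset w)    ≡⟨ cong₂ combine s≡ o≡ ⟩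
      combine (slope w′) (offset w′)  ≡⟨ Fin.combine-remQuot {p} q (inner w′) ⟩
      inner w′                        ∎) ⟩
    combine (block w′) (inner w′) ≡⟨ combine-block-inner w′ ⟩
    w′                            ∎
    where open ≡-Reasoning

  -- `combine` is lexicographic, with the block as leading digit.
  block-<⇒< : ∀ {w w′} → block w Fin.< block w′ → w Fin.< w′
  block-<⇒< {w} {w′} b< = subst₂ Fin._<_ (combine-block-inner w) (combine-block-inner w′)
    (Fin.combine-monoˡ-< (inner w) (inner w′) b<)

  curve : Fin n → Fin q → ℕ
  curve u t = toℕ (offset u) + (toℕ (slope u) + toℕ (block u) * toℕ t) * toℕ t

  -- The leading coefficient is a nonzero residue, so each row (i , a , b) is
  -- equidistributed as a function of the offset of the other vertex.
  line : Fin p → Fin q → ℕ → ℕ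
  line a b x = suc (toℕ a) * x + toℕ b

  -- The first vertex supplies a line and an evaluation point, the second its quadratic. The 3-graph
  -- reads colours only with the lower vertex first.
  value : Fin n → Fin n → ℕ
  value w u = line (slope w) (offset w) (curve u (block w)) % q

  value<q : ∀ w u → value w u < q
  value<q w u = m%n<n (line (slope w) (offset w) (curve u (block w))) q

  colour : Fin n → Fin n → ℕ
  colour w u = value w u % s

  colour<s : ∀ w u → colour w u < s
  colour<s w u = m%n<n (value w u) s

  pos-line : ∀ a b x → + line a b x ≡ + suc (toℕ a) ℤ.* + x ℤ.+ + toℕ b
  pos-line a b x = trans (ℤ.pos-+ (suc (toℕ a) * x) (toℕ b)) (cong (ℤ._+ + toℕ b) (ℤ.pos-* (suc (toℕ a)) x))

  pos-bend : ∀ i a t → + ((a + i * t) * t) ≡ (+ a ℤ.+ + i ℤ.* + t) ℤ.* + t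
  pos-bend i a t = trans (ℤ.pos-* (a + i * t) t)
    (cong (ℤ._* + t) (trans (ℤ.pos-+ a (i * t)) (cong (ℤ._+_ (+ a)) (ℤ.pos-* i t))))

  pos-curve : ∀ u t → + curve u t ≡
    quadratic (+ toℕ (block u)) (+ toℕ (slope u)) (+ toℕ (offset u)) (+ toℕ t)
  pos-curve u t = trans (ℤ.pos-+ (toℕ (offset u)) _)
    (cong (ℤ._+_ (+ toℕ (offset u))) (pos-bend (toℕ (block u)) (toℕ (slope u)) (toℕ t)))

  ≈⇒Fin≡ : ∀ {x y : Fin q} → + toℕ x ≈ + toℕ y → x ≡ y
  ≈⇒Fin≡ {x} {y} e = Fin.toℕ-injective (≈⇒≡ (Fin.toℕ<n x) (Fin.toℕ<n y) e)

  slope<q : ∀ (a : Fin p) → toℕ a < q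
  slope<q a = ℕ.m<n⇒m<1+n (Fin.toℕ<n a)

  -- All coefficients are below `q`, as `suc (toℕ a)` is at most `p`, so the congruences from
  -- `two-points` are equalities. This recovers the slope and offset of a vertex below `u` from its
  -- values with `u` and `v`.
  line-injective : ∀ x y a a′ b b′ → x % q ≢ y % q →
    line a b x % q ≡ line a′ b′ x % q → line a b y % q ≡ line a′ b′ y % q → a ≡ a′ × b ≡ b′
  line-injective x y a a′ b b′ x≢y ex ey =
    let α≈ , β≈ = two-points _ _ _ _ (+ x) (+ y) (x≢y ∘ ≈⇒%≡ x y)
                    (subst₂ _≈_ (pos-line a b x) (pos-line a′ b′ x) (%≡⇒≈ (line a b x) (line a′ b′ x) ex))
                    (subst₂ _≈_ (pos-line a b y) (pos-line a′ b′ y) (%≡⇒≈ (line a b y) (line a′ b′ y) ey))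
    in Fin.toℕ-injective (ℕ.suc-injective (≈⇒≡ (s≤s (Fin.toℕ<n a)) (s≤s (Fin.toℕ<n a′)) α≈)) , ≈⇒Fin≡ β≈

  -- Equal block and slope leave two curves at `t` differing only by their offsets, and the leading
  -- coefficient of the line is invertible. This recovers a vertex above `u`.
  curve-offset-injective : ∀ a b w w′ t → block w ≡ block w′ → slope w ≡ slope w′ →
    line a b (curve w t) % q ≡ line a b (curve w′ t) % q → offset w ≡ offset w′
  curve-offset-injective a b w w′ t b≡ s≡ e = ≈⇒Fin≡
    (affine-injective (+ suc (toℕ a)) (+ toℕ b) _ _ (+ bend w) a≉0
      (subst₂ _≈_ (expand w refl) (expand w′ (sym bend≡)) (%≡⇒≈ (line a b (curve w t)) (line a b (curve w′ t)) e)))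
    where
    bend : Fin n → ℕ
    bend w = (toℕ (slope w) + toℕ (block w) * toℕ t) * toℕ t

    bend≡ : bend w ≡ bend w′
    bend≡ = cong₂ (λ i a → (toℕ a + toℕ i * toℕ t) * toℕ t) b≡ s≡

    expand : ∀ u {k} → bend u ≡ k →
      + line a b (curve u t) ≡ + suc (toℕ a) ℤ.* (+ toℕ (offset u) ℤ.+ + k) ℤ.+ + toℕ b
    expand u refl = trans (pos-line a b (curve u t))
      (cong (λ z → + suc (toℕ a) ℤ.* z ℤ.+ + toℕ b) (ℤ.pos-+ (toℕ (offset u)) (bend u)))

    a≉0 : ¬ + suc (toℕ a) ≈ + 0
    a≉0 e = case ≈⇒≡ (s≤s (Fin.toℕ<n a)) (s≤s z≤n) e of λ ()

  -- Three common points would force all three coefficients to be congruent; being below `q` they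
  -- would be equal, and they determine the vertex.
  curves-meet : ∀ {u v} → u ≢ v → AtMostTwo λ t → curve u t % q ≡ curve v t % q
  curves-meet {u} {v} u≢v {i} {j} {k} ei ej ek i≢j i≢k j≢k =
    let a≈ , b≈ , c≈ = quadratic-roots (+ toℕ (block u)) (+ toℕ (slope u)) (+ toℕ (offset u))
                         (+ toℕ (block v)) (+ toℕ (slope v)) (+ toℕ (offset v)) _ _ _
                         (i≢j ∘ ≈⇒Fin≡) (i≢k ∘ ≈⇒Fin≡) (j≢k ∘ ≈⇒Fin≡) (meet i ei) (meet j ej) (meet k ek)
    in u≢v (vertex-≡ (≈⇒Fin≡ a≈)
         (Fin.toℕ-injective (≈⇒≡ (slope<q (slope u)) (slope<q (slope v)) b≈)) (≈⇒Fin≡ c≈))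
    where
    parabola : ℤ → Fin n → ℤ
    parabola t u = quadratic (+ toℕ (block u)) (+ toℕ (slope u)) (+ toℕ (offset u)) t

    meet : ∀ t → curve u t % q ≡ curve v t % q → parabola (+ toℕ t) u ≈ parabola (+ toℕ t) v
    meet t e = subst₂ _≈_ (pos-curve u t) (pos-curve v t) (%≡⇒≈ (curve u t) (curve v t) e)

  -- A bad w is recorded by its block, one further residue, and the quotient by s
  -- of a second residue, whose remainder (the colour) is forced by badness. This
  -- does not apply in the block of u and in the at most two blocks where the curves
  -- of u and v meet; vertices there are recorded in full.
  codes : ℕ
  codes = q * (q * suc (q ℕ./ s)) + 3 * (p * q)

  quotient : Fin n → Fin n → Fin (suc (q ℕ./ s))
  quotient w u = fromℕ< (s≤s (/-monoˡ-≤ s (ℕ.<⇒≤ (value<q w u))))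

  value-≡ : ∀ {w u w′ u′} → colour w u ≡ colour w′ u′ → quotient w u ≡ quotient w′ u′ →
    value w u ≡ value w′ u′
  value-≡ c≡ q≡ = %-/-injective s c≡ (Fin.fromℕ<-injective _ _ _ _ q≡)

  module _ (u v : Fin n) (u≢v : u ≢ v) where

    Meet : Pred (Fin q) 0ℓ
    Meet t = curve u t % q ≡ curve v t % q

    meet? : Decidable Meet
    meet? t = curve u t % q ℕ.≟ curve v t % q

    -- In the block of `u`, blocks do not decide whether `w` is below `u`. In a block below it where
    -- the curves meet, every `w` gives its pairs with `u` and `v` the same colour.
    Special : Pred (Fin q) 0ℓ
    Special t = t ≡ block u ⊎ Meet t

    specialCode : Σ (Fin q → Fin 3) λ t → ∀ {i j} → Special i → Special j → t i ≡ t j → i ≡ j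
    specialCode = tag , tag-inj
      where
      meetCode = atMostTwo⇒code meet? (curves-meet u≢v)

      tag : Fin q → Fin 3
      tag i with i Fin.≟ block u
      ... | yes _ = Fin.zero
      ... | no  _ = Fin.suc (proj₁ meetCode i)

      tag-inj : ∀ {i j} → Special i → Special j → tag i ≡ tag j → i ≡ j
      tag-inj {i} {j} si sj eq with i Fin.≟ block u | j Fin.≟ block u
      ... | yes i≡ | yes j≡ = trans i≡ (sym j≡)
      ... | no i≢  | no j≢  = proj₂ meetCode ([ (λ e → contradiction e i≢) , id ]′ si)
                                ([ (λ e → contradiction e j≢) , id ]′ sj) (Fin.suc-injective eq)

    data Zone (t : Fin q) : Set where
      special : Special t → Zone t
      below   : t Fin.< block u → ¬ Meet t → Zone t
      above   : block u Fin.< t → Zone t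

    zone : ∀ t → Zone t
    zone t with meet? t | Fin.<-cmp t (block u)
    ... | yes m | _            = special (inj₂ m)
    ... | no ¬m | tri< t<  _ _ = below t< ¬m
    ... | no ¬m | tri≈ _  t≡ _ = special (inj₁ t≡)
    ... | no ¬m | tri> _ _  t> = above t>

    -- For a bad `w` below, the remainder of `value w v` is that of the recorded `value w u`; above,
    -- the remainder of `value u w` is `colour u v`. `inject₁` lets both zones share one code type,
    -- and the recorded block tells them apart.
    code : Fin n → (Fin q × Fin q × Fin (suc (q ℕ./ s))) ⊎ (Fin 3 × Fin p × Fin q)
    code w with zone (block w)
    ... | special _ = inj₂ (proj₁ specialCode (block w) , slope w , offset w)
    ... | below _ _ = inj₁ (block w , fromℕ< (value<q w u) , quotient w v)
    ... | above _   = inj₁ (block w , inject₁ (slope w) , quotient u w)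

    -- The order of the blocks settles `w < u`, so the other conditions of `Good` hold and only the
    -- colour inequality can fail.
    ¬good⇒below : ∀ {w} → ¬ Good colour u v w → block w Fin.< block u → colour w u ≡ colour w v
    ¬good⇒below {w} bad b< = decidable-stable (_ ℕ.≟ _) λ c≢ →
      bad (Fin.<⇒≢ w<u , (λ _ → c≢) , λ u<w → contradiction w<u (Fin.<-asym u<w))
      where w<u = block-<⇒< b<

    ¬good⇒above : ∀ {w} → ¬ Good colour u v w → block u Fin.< block w → colour u w ≡ colour u v
    ¬good⇒above {w} bad b< = decidable-stable (_ ℕ.≟ _) λ c≢ →
      bad (≢-sym (Fin.<⇒≢ u<w) , (λ w<u → contradiction w<u (Fin.<-asym u<w)) , λ _ → c≢)
      where u<w = block-<⇒< b<

    code-injective : ∀ {w w′} → ¬ Good colour u v w → ¬ Good colour u v w′ → code w ≡ code w′ → w ≡ w′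
    code-injective {w} {w′} bad bad′ eq with zone (block w) | zone (block w′)
    ... | special z | special z′ =
      let t≡ , r = ,-injective (inj₂-injective eq)
          s≡ , o≡ = ,-injective r
      in vertex-≡ (proj₂ specialCode z z′ t≡) s≡ o≡
    -- The lines of `w` and `w′` agree at the values of the curves of `u` and `v`, which are
    -- incongruent because the block is not a meeting point.
    ... | below b< ¬m | below b<′ _ =
      let b≡ , r   = ,-injective (inj₁-injective eq)
          vu≡ , q≡ = ,-injective r
          vu≡      = Fin.fromℕ<-injective _ _ _ _ vu≡
          vv≡      = value-≡ (trans (sym (¬good⇒below bad b<))
                       (trans (cong (_% s) vu≡) (¬good⇒below bad′ b<′))) q≡
          at z     = cong (λ t → line (slope w′) (offset w′) (curve z t) % q) (sym b≡)
          s≡ , o≡  = line-injective (curve u (block w)) (curve v (block w)) _ _ _ _ ¬m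
                       (trans vu≡ (at u)) (trans vv≡ (at v))
      in vertex-≡ b≡ s≡ o≡
    -- Both values have the remainder `colour u v`, so equal quotients make them equal.
    ... | above b> | above b>′ =
      let b≡ , r   = ,-injective (inj₁-injective eq)
          s≡ , q≡  = ,-injective r
          s≡       = Fin.inject₁-injective s≡
          v≡       = value-≡ (trans (¬good⇒above bad b>) (sym (¬good⇒above bad′ b>′))) q≡
      in vertex-≡ b≡ s≡ (curve-offset-injective (slope u) (offset u) w w′ (block u) b≡ s≡ v≡)
    ... | below b< _ | above b> =
      contradiction (subst (Fin._< block u) (proj₁ (,-injective (inj₁-injective eq))) b<) (Fin.<-asym b>)
    ... | above b> | below b< _ =
      contradiction (subst (block u Fin.<_) (proj₁ (,-injective (inj₁-injective eq))) b>) (Fin.<-asym b<)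

  manyGood : ∀ {u v} → u Fin.< v → AtLeast (n ∸ codes) (Good colour u v)
  manyGood {u} {v} u<v = AtLeast-complement (good? colour u v) (pack ∘ code u v u≢v)
    λ bad bad′ eq → code-injective u v u≢v bad bad′ (pack-injective eq)
    where u≢v = Fin.<⇒≢ u<v

  attainable : Attainable n ｛ s + 2 , K (s + 2) ｝ (n ∸ codes)
  attainable = rainbow-attainable colour colour<s manyGood

-- Asymptotics of the codegree

module _ (s′ p : ℕ) (q-prime : Prime (suc p)) where
  open Construction (suc s′) p q-prime

  -- The 5 collects multiples of `s q²`: one because `n` is `q³ - q²`, one from the `suc` in the
  -- number of quotients, and three from the special blocks.
  codegree-bound : s′ * (q * (q * q)) ≤ suc s′ * (n ∸ codes) + 5 * (suc s′ * (q * q))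
  codegree-bound = ℕ.+-cancelˡ-≤ (q * (q * q)) _ _ (begin
    q * (q * q) + s′ * (q * (q * q))
      ≡⟨ total s′ p ⟩
    s * n + s * (q * q)
      ≤⟨ ℕ.+-monoˡ-≤ (s * (q * q)) (ℕ.*-monoʳ-≤ s (ℕ.m≤n+m∸n n codes)) ⟩
    s * (codes + d) + s * (q * q)
      ≡⟨ split s (q ℕ./ s) p d ⟩
    s * d + q * q * (q ℕ./ s * s) + 2 * (s * (q * q)) + 3 * (s * (p * q))
      ≤⟨ ℕ.+-mono-≤ (ℕ.+-monoˡ-≤ _ (ℕ.+-monoʳ-≤ (s * d) (ℕ.*-monoʳ-≤ (q * q) (m/n*n≤m q s))))
           (ℕ.*-monoʳ-≤ 3 (ℕ.*-monoʳ-≤ s (ℕ.*-monoˡ-≤ q (ℕ.n≤1+n p)))) ⟩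
    s * d + q * q * q + 2 * (s * (q * q)) + 3 * (s * (q * q))
      ≡⟨ collect s q d ⟩
    q * (q * q) + (s * d + 5 * (s * (q * q))) ∎)
    where
    open ℕ.≤-Reasoning
    s d : ℕ
    s = suc s′
    d = n ∸ codes

    total : ∀ s′ p → suc p * (suc p * suc p) + s′ * (suc p * (suc p * suc p)) ≡
      suc s′ * (suc p * (p * suc p)) + suc s′ * (suc p * suc p)
    total = ℕSolver.solve-∀

    split : ∀ s t p d →
      s * ((suc p * (suc p * suc t) + 3 * (p * suc p)) + d) + s * (suc p * suc p) ≡
      s * d + suc p * suc p * (t * s) + 2 * (s * (suc p * suc p)) + 3 * (s * (p * suc p))
    split = ℕSolver.solve-∀

    collect : ∀ s q d → s * d + q * q * q + 2 * (s * (q * q)) + 3 * (s * (q * q)) ≡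
      q * (q * q) + (s * d + 5 * (s * (q * q)))
    collect = ℕSolver.solve-∀

-- The integer `s′ D - P s` is at least 1. Scaled by `q³` it contributes `q³`, which exceeds the
-- error `5 D s q²` once `q > 5 D s`.
ratio-bound : ∀ {P D s′ q d} .⦃ _ : NonZero q ⦄ → P * suc s′ < s′ * D → 5 * (D * suc s′) < q →
  s′ * (q * (q * q)) ≤ suc s′ * d + 5 * (suc s′ * (q * q)) → P * (q * (q * q)) < d * D
ratio-bound {P} {D} {s′} {q} {d} gap large bound =
  ℕ.*-cancelˡ-< s _ _ (ℕ.+-cancelʳ-< (q * (q * q)) _ _ (begin-strict
    s * (P * Q) + Q                      ≡⟨ regroup s P Q ⟩
    suc (P * s) * Q                      ≤⟨ ℕ.*-monoˡ-≤ Q gap ⟩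
    s′ * D * Q                           ≡⟨ swap s′ D Q ⟩
    D * (s′ * Q)                         ≤⟨ ℕ.*-monoʳ-≤ D bound ⟩
    D * (s * d + 5 * (s * (q * q)))      ≡⟨ expand D s d q ⟩
    s * (d * D) + 5 * (D * s) * (q * q)  <⟨ ℕ.+-monoʳ-< (s * (d * D)) (ℕ.*-monoˡ-< (q * q) ⦃ ℕ.m*n≢0 q q ⦄ large) ⟩
    s * (d * D) + Q                      ∎))
  where
  open ℕ.≤-Reasoning
  s Q : ℕ
  s = suc s′
  Q = q * (q * q)

  regroup : ∀ s P Q → s * (P * Q) + Q ≡ suc (P * s) * Q
  regroup = ℕSolver.solve-∀

  swap : ∀ s D Q → s * D * Q ≡ D * (s * Q)
  swap = ℕSolver.solve-∀

  expand : ∀ D s d q → D * (s * d + 5 * (s * (q * q))) ≡ s * (d * D) + 5 * (D * s) * (q * q)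
  expand = ℕSolver.solve-∀

-- As an unnormalised fraction the bound has numerator `s′` and denominator `suc s′`, ready for
-- cross-multiplication.
1-1/s≃ : ∀ s′ → ℚ.toℚᵘ (1ℚ ℚ.- + 1 ℚ./ suc s′) ℚᵘ.≃ mkℚᵘ (+ s′) s′
1-1/s≃ s′ = begin-equality
  ℚ.toℚᵘ (1ℚ ℚ.- + 1 ℚ./ suc s′)             ≃⟨ ℚ.toℚᵘ-homo-+ 1ℚ (ℚ.- (+ 1 ℚ./ suc s′)) ⟩
  ℚᵘ.1ℚᵘ ℚᵘ.+ ℚ.toℚᵘ (ℚ.- (+ 1 ℚ./ suc s′))   ≃⟨ ℚᵘ.+-congʳ ℚᵘ.1ℚᵘ (ℚ.toℚᵘ-homo‿- (+ 1 ℚ./ suc s′)) ⟩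
  ℚᵘ.1ℚᵘ ℚᵘ.- ℚ.toℚᵘ (+ 1 ℚ./ suc s′)         ≃⟨ ℚᵘ.+-congʳ ℚᵘ.1ℚᵘ (ℚᵘ.-‿cong (ℚ.toℚᵘ-fromℚᵘ (mkℚᵘ (+ 1) s′))) ⟩
  ℚᵘ.1ℚᵘ ℚᵘ.- mkℚᵘ (+ 1) s′                   ≃⟨ ℚᵘ.*≡* (identity (+ s′)) ⟩
  mkℚᵘ (+ s′) s′                             ∎
  where
  open ℚᵘ.≤-Reasoning
  identity : ∀ s → (+ 1 ℤ.* (+ 1 ℤ.+ s) ℤ.+ -[1+ 0 ] ℤ.* + 1) ℤ.* (+ 1 ℤ.+ s) ≡
    s ℤ.* (+ 1 ℤ.* (+ 1 ℤ.+ s))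
  identity = ℤSolver.solve-∀

1-1/s-gap : ∀ {x} s′ → x ℚ.< 1ℚ ℚ.- + 1 ℚ./ suc s′ → ℚ.↥ x ℤ.* + suc s′ ℤ.< + s′ ℤ.* ℚ.↧ x
1-1/s-gap {x@record{}} s′ x<r = ℚᵘ.drop-*<* (ℚᵘ.<-respʳ-≃ (1-1/s≃ s′) (ℚ.toℚᵘ-mono-< x<r))

<-/ : ∀ {x d m} → ℚ.↥ x ℤ.* + suc m ℤ.< + d ℤ.* ℚ.↧ x → x ℚ.< + d ℚ./ suc m
<-/ {x@record{}} {d} {m} lt = ℚ.toℚᵘ-cancel-<
  (ℚᵘ.<-respʳ-≃ (ℚᵘ.≃-sym (ℚ.toℚᵘ-fromℚᵘ (mkℚᵘ (+ d) m))) (*<* lt))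

-- The ratio is at least `d / q³`, so `ratio-bound` applies to a nonnegative `x`. A negative `x` is
-- below every ratio of naturals.
x<ratio : ∀ {x s′ q d e m} .⦃ _ : NonZero q ⦄ → x ℚ.< 1ℚ ℚ.- + 1 ℚ./ suc s′ →
  5 * (ℚ.↧ₙ x * suc s′) < q → s′ * (q * (q * q)) ≤ suc s′ * d + 5 * (suc s′ * (q * q)) →
  d ≤ e → suc m ≤ q * (q * q) → x ℚ.< + e ℚ./ suc m
x<ratio {x@(mkℚ -[1+ P ] D-1 _)} {e = e} {m} x<r large bound d≤e m<q³ = <-/ {x} {e} {m}
  (subst (-[1+ P ] ℤ.* + suc m ℤ.<_) (ℤ.pos-* e (suc D-1)) ℤ.-<+)
x<ratio {x@(mkℚ (+ P) D-1 _)} {s′} {q} {d} {e} {m} x<r large bound d≤e m<q³ = <-/ {x} {e} {m}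
  (subst₂ ℤ._<_ (ℤ.pos-* P (suc m)) (ℤ.pos-* e D) (ℤ.+<+ (begin-strict
    P * suc m          ≤⟨ ℕ.*-monoʳ-≤ P m<q³ ⟩
    P * (q * (q * q))  <⟨ ratio-bound {P} {D} {s′} {q} {d} gap large bound ⟩
    d * D              ≤⟨ ℕ.*-monoˡ-≤ D d≤e ⟩
    e * D              ∎)))
  where
  open ℕ.≤-Reasoning
  D = suc D-1

  gap : P * suc s′ < s′ * D
  gap = ℤ.drop‿+<+ (subst₂ ℤ._<_ (sym (ℤ.pos-* P (suc s′))) (sym (ℤ.pos-* s′ D)) (1-1/s-gap {x} s′ x<r))

-- Passage to the limit

<-shift : ∀ {x y z} → y ℚ.< z → x ℚ.< z ℚ.- (y ℚ.- x)
<-shift {x} {y} {z} y<z = subst (ℚ._< z ℚ.- (y ℚ.- x)) x≡ (ℚ.+-monoˡ-< (ℚ.- (y ℚ.- x)) y<z)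
  where
  open AbelianGroup ℚ.+-0-abelianGroup using (⁻¹-anti-homo‿-; xyx⁻¹≈y)
  x≡ : y ℚ.- (y ℚ.- x) ≡ x
  x≡ = trans (cong (ℚ._+_ y) (⁻¹-anti-homo‿- y x)) (trans (sym (ℚ.+-assoc y x (ℚ.- y))) (xyx⁻¹≈y y x))

<⇒0<- : ∀ {x y} → x ℚ.< y → 0ℚ ℚ.< y ℚ.- x
<⇒0<- {x} {y} x<y = subst (ℚ._< y ℚ.- x) (ℚ.+-inverseʳ x) (ℚ.+-monoˡ-< (ℚ.- x) x<y)

-- The index `m` is `n - 3`, as in the sequence defining the density. The bound covers every `e`
-- from `d` on because `coex` is only known to be at least `d`.
attainable-ratio : ∀ s′ {x} → x ℚ.< 1ℚ ℚ.- + 1 ℚ./ suc s′ → ∀ N →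
  ∃₂ λ m d → N ≤ m × Attainable (3 + m) ｛ suc s′ + 2 , K (suc s′ + 2) ｝ d ×
    (∀ e → d ≤ e → x ℚ.< + e ℚ./ suc m)
-- The summand `3 + N` makes `n` large enough for `N ≤ m`; the other one absorbs the error term of
-- the codegree bound.
attainable-ratio s′ {x} x<r N with primeAbove (3 + N + 5 * (ℚ.↧ₙ x * suc s′))
... | suc p , q-prime , large =
  n ∸ 3 , n ∸ codes , N≤m ,
  subst (λ k → Attainable k ｛ suc s′ + 2 , K (suc s′ + 2) ｝ (n ∸ codes)) (sym 3+m≡n) attainable ,
  λ e d≤e → x<ratio {x} {s′} {q} {n ∸ codes} {e} {n ∸ 3} x<r
    (ℕ.≤-<-trans (ℕ.m≤n+m _ (3 + N)) large) (codegree-bound s′ p q-prime) d≤e m<q³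
  where
  open Construction (suc s′) p q-prime

  N+3≤n : 3 + N ≤ n
  N+3≤n = begin
    3 + N        ≤⟨ ℕ.m≤m+n (3 + N) _ ⟩
    _            ≤⟨ ℕ.≤-pred large ⟩
    p            ≤⟨ ℕ.m≤m*n p q ⟩
    p * q        ≤⟨ ℕ.m≤n*m (p * q) q ⟩
    n            ∎
    where open ℕ.≤-Reasoning

  3+m≡n : 3 + (n ∸ 3) ≡ n
  3+m≡n = ℕ.m+[n∸m]≡n (ℕ.≤-trans (ℕ.m≤m+n 3 N) N+3≤n)

  N≤m : N ≤ n ∸ 3
  N≤m = ℕ.+-cancelˡ-≤ 3 N (n ∸ 3) (subst (3 + N ≤_) (sym 3+m≡n) N+3≤n)

  m<q³ : suc (n ∸ 3) ≤ q * (q * q)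
  m<q³ = begin
    suc (n ∸ 3)  ≤⟨ ℕ.m≤n+m (suc (n ∸ 3)) 2 ⟩
    3 + (n ∸ 3)  ≡⟨ 3+m≡n ⟩
    q * (p * q)  ≤⟨ ℕ.*-monoʳ-≤ q (ℕ.*-monoˡ-≤ q (ℕ.n≤1+n p)) ⟩
    q * (q * q)  ∎
    where open ℕ.≤-Reasoning

theorem5 : (s : ℕ) → .{{_ : NonZero s}} → 2 ≤ s →
    (γ : ℝ) → IsCodegreeDensityOf (K (s + 2)) γ →
    γ ≥ᵣ fromℚ (1ℚ - + 1 / s)
theorem5 (suc s′) _ γ density {x} x<r =
  let open IsCodegreeDensity density
      -- The gap `y - x` serves as tolerance: at a late index the ratio exceeds `y`, and the limit
      -- exceeds the ratio minus `y - x`, hence `x`.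
      y , x<y , y<r                  = ℚ.<-dense x<r
      N , near                       = isLimit (y ℚ.- x) (<⇒0<- x<y)
      m , d , N≤m , attained , y<e/m = attainable-ratio s′ y<r N
      d≤coex                         = proj₂ (isCoex (3 + m) (s≤s (s≤s z≤n))) d attained
  in L-lower γ (<-shift {x} {y} (y<e/m (coex (3 + m)) d≤coex)) (proj₁ (near m N≤m))
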